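{- For any graph $G=G_1\sqcup G_2$ with no edges connecting $G_1$ to $G_2$, we have $\lfloor \mathrm{sp}\rfloor(G)=\lfloor \mathrm{sp}\rfloor(G_1)+\lfloor \mathrm{sp}\rfloor(G_2)$.
   Context: All graphs are finite, have at least one vertex, have no loops, and may have multiple (parallel) edges. A unique shortest path is a shortest $u$–$v$ path $P$ such that every $u$–$v$ path with the same number of vertices is identical to $P$, where two paths with different edge sequences are different even if their vertex sequences agree; a single vertex is a unique shortest path. The parade number $\mathrm{usp}(G)$ is the largest number of vertices of a unique shortest path in $G$. The spectator number is $\mathrm{sp}(G)=|V(G)|-\mathrm{usp}(G)$. A minor of $H$ is any graph obtained from $H$ by a sequence of: deleting an isolated vertex, deleting an edge, contracting an edge that has no edge parallel to it. The spectator floor $\lfloor \mathrm{sp}\rfloor(G)$ is the minimum of $\mathrm{sp}(H)$ over all graphs $H$ of which $G$ is a minor. -}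

module Defs where

open import Data.Fin.Base using (Fin)
open import Data.Fin.Properties using (+↔⊎)
open import Data.List.Base using (List; []; _∷_; length)
open import Data.List.Relation.Unary.Unique.Propositional using (Unique)
open import Data.Nat.Base using (ℕ; _+_; _∸_; _≤_)
open import Data.Product.Base using (∃; ∃-syntax; _×_; _,_; proj₁; proj₂; map)
open import Data.Sum.Base using (_⊎_; inj₁; inj₂; [_,_])
open import Data.Sum.Function.Propositional using (_⊎-↔_)
open import Data.Sum.Properties using (inj₁-injective; inj₂-injective)
open import Function.Base using (_∘_)
open import Function.Bundles using (_↔_; Inverse)
open import Function.Construct.Composition using (_↔-∘_)
open import Function.Construct.Symmetry using (↔-sym)
open import Function.Definitions using (Injective; Surjective)
open import Relation.Binary.Construct.Closure.ReflexiveTransitive using (Star)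
open import Relation.Binary.PropositionalEquality using (_≡_; _≢_)
open import Relation.Nullary.Negation using (¬_)

-- Edges are a type of their own, so parallel edges are distinct edges with
-- the same ends.  The order in which `ends` lists the two ends of an edge is
-- an artefact; everything below goes through the symmetric relation `Joins`.
record Graph : Set₁ where
  field
    V E      : Set
    order    : ℕ
    size     : ℕ
    V↔Fin    : V ↔ Fin order
    E↔Fin    : E ↔ Fin size
    nonempty : V
    ends     : E → V × V
    loopless : ∀ e → proj₁ (ends e) ≢ proj₂ (ends e)

  Joins : E → V → V → Set
  Joins e u v = ends e ≡ (u , v) ⊎ ends e ≡ (v , u)

open Graph public

infix 1 _⊔_
_⊔_ : Graph → Graph → Graph
G₁ ⊔ G₂ = record
  { V        = V G₁ ⊎ V G₂
  ; E        = E G₁ ⊎ E G₂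
  ; order    = order G₁ + order G₂
  ; size     = size G₁ + size G₂
  ; V↔Fin    = ↔-sym +↔⊎ ↔-∘ (V↔Fin G₁ ⊎-↔ V↔Fin G₂)
  ; E↔Fin    = ↔-sym +↔⊎ ↔-∘ (E↔Fin G₁ ⊎-↔ E↔Fin G₂)
  ; nonempty = inj₁ (nonempty G₁)
  ; ends     = [ map inj₁ inj₁ ∘ ends G₁ , map inj₂ inj₂ ∘ ends G₂ ]
  ; loopless = λ where
      (inj₁ e) → loopless G₁ e ∘ inj₁-injective
      (inj₂ e) → loopless G₂ e ∘ inj₂-injective
  }

-- Every edge has exactly one unordered pair of ends, so here and in the minor
-- operations it is enough that incidence is preserved in one direction.
infix 0 _≅_
record _≅_ (G H : Graph) : Set where
  field
    onV       : V G ↔ V H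
    onE       : E G ↔ E H
    preserves : ∀ e u v → Joins G e u v →
                Joins H (Inverse.to onE e) (Inverse.to onV u) (Inverse.to onV v)

module _ (G : Graph) where

  data Walk : V G → V G → Set where
    []  : ∀ {v} → Walk v v
    _∷_ : ∀ {u w v} → (∃[ e ] Joins G e u w) → Walk w v → Walk u v

module _ {G : Graph} where

  vertices : ∀ {u v} → Walk G u v → List (V G)
  vertices {u} []      = u ∷ []
  vertices {u} (_ ∷ P) = u ∷ vertices P

  edges : ∀ {u v} → Walk G u v → List (E G)
  edges []            = []
  edges ((e , _) ∷ P) = e ∷ edges P

  #vertices : ∀ {u v} → Walk G u v → ℕ
  #vertices P = length (vertices P)

  IsPath : ∀ {u v} → Walk G u v → Set
  IsPath P = Unique (vertices P)

  Identical : ∀ {u v} → Walk G u v → Walk G u v → Set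
  Identical P Q = vertices P ≡ vertices Q × edges P ≡ edges Q

  record IsUniqueShortestPath {u v} (P : Walk G u v) : Set where
    field
      isPath   : IsPath P
      shortest : ∀ (Q : Walk G u v) → IsPath Q → #vertices P ≤ #vertices Q
      unique   : ∀ (Q : Walk G u v) → IsPath Q → #vertices Q ≡ #vertices P → Identical Q P

IsGreatest : ∀ {ℓ} → (ℕ → Set ℓ) → ℕ → Set ℓ
IsGreatest A m = A m × (∀ n → A n → n ≤ m)

IsLeast : ∀ {ℓ} → (ℕ → Set ℓ) → ℕ → Set ℓ
IsLeast A m = A m × (∀ n → A n → m ≤ n)

-- usp, sp and ⌊sp⌋ are relations: `IsParadeNumber G p` says usp(G) = p, and so
-- on.  A least element of an inhabited set of naturals need not be computable,
-- so ⌊sp⌋ is not given as a function.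
IsParadeNumber : Graph → ℕ → Set
IsParadeNumber G = IsGreatest λ n →
  ∃[ u ] ∃[ v ] ∃[ P ] (IsUniqueShortestPath {G} {u} {v} P × #vertices P ≡ n)

IsSpectatorNumber : Graph → ℕ → Set
IsSpectatorNumber G s = ∃[ p ] (IsParadeNumber G p × s ≡ order G ∸ p)

-- A ≃ B ∖ b : a bijection from A onto B with the single element b removed.
infix 0 _≃_∖_
record _≃_∖_ (A B : Set) (b : B) : Set where
  field
    to        : A → B
    injective : Injective _≡_ _≡_ to
    avoids    : ∀ a → to a ≢ b
    covers    : ∀ x → x ≢ b → ∃[ a ] to a ≡ x

-- In each of the following, G is (up to isomorphism) the result of applying
-- the operation to H.
record VertexDeletion (H G : Graph) : Set where
  field
    deleted   : V H
    isolated  : ∀ e u → ¬ Joins H e deleted u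
    onV       : V G ≃ V H ∖ deleted
    onE       : E G ↔ E H
    preserves : ∀ e x y → Joins G e x y →
                Joins H (Inverse.to onE e) (_≃_∖_.to onV x) (_≃_∖_.to onV y)

record EdgeDeletion (H G : Graph) : Set where
  field
    deleted   : E H
    onV       : V G ↔ V H
    onE       : E G ≃ E H ∖ deleted
    preserves : ∀ e x y → Joins G e x y →
                Joins H (_≃_∖_.to onE e) (Inverse.to onV x) (Inverse.to onV y)

-- `quotient` identifies the two ends of the contracted edge and nothing else.
record Contraction (H G : Graph) : Set where
  field
    contracted : E H
    u v        : V H
    joins      : Joins H contracted u v
    noParallel : ∀ f → Joins H f u v → f ≡ contracted
    quotient   : V H → V G
    surjective : Surjective _≡_ _≡_ quotient
    identifies : quotient u ≡ quotient v
    separates  : ∀ x y → quotient x ≡ quotient y →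
                 x ≡ y ⊎ (x ≡ u × y ≡ v) ⊎ (x ≡ v × y ≡ u)
    onE        : E G ≃ E H ∖ contracted
    preserves  : ∀ f x y → Joins H (_≃_∖_.to onE f) x y →
                 Joins G f (quotient x) (quotient y)

infix 0 _⟶_
data _⟶_ (H G : Graph) : Set where
  deleteVertex : VertexDeletion H G → H ⟶ G
  deleteEdge   : EdgeDeletion H G → H ⟶ G
  contractEdge : Contraction H G → H ⟶ G

infix 0 _IsMinorOf_
_IsMinorOf_ : Graph → Graph → Set₁
G IsMinorOf H = ∃[ H′ ] (Star _⟶_ H H′ × (H′ ≅ G))

IsSpectatorFloor : Graph → ℕ → Set₁
IsSpectatorFloor G = IsLeast λ s →
  ∃[ H ] ((G IsMinorOf H) × IsSpectatorNumber H s)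

{-# OPTIONS --safe #-}
module Submission where

-- Call order H ∸ #P a candidate for G when G is a minor of H and P is a unique
-- shortest path of H; the spectator floor of G is the least candidate.
--
-- ≥: Let G₁ ⊔ G₂ be a minor of H and P a unique shortest path of H.  Pulling the
-- bipartition of G₁ ⊔ G₂ back along the minor operations 2-colours H so that Gᵢ
-- is a minor of the i-th colour class.  Adding P to that class keeps P a unique
-- shortest path, and the two vertex sets overlap in P only, so the two spectator
-- counts add up to the one of H.
--
-- ≤: Joining the last vertex of P₁ in H₁ to the first vertex of P₂ in H₂ by a
-- bridge makes the concatenation of P₁ and P₂ a unique shortest path.

open import Defs
open import Data.Bool as Bool using (Bool; true; false)
open import Data.Bool.Properties using (¬-not)
open import Data.Empty using (⊥-elim)
open import Data.Fin using (Fin; zero; suc)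
import Data.Fin.Properties as Fin
open import Data.Irrelevant as Irrelevant using ([_])
open import Data.List using (List; []; _∷_; _++_; map; length; lookup)
open import Data.List.Properties using (length-map; map-injective)
import Data.List.Membership.DecPropositional as DecMembership
open import Data.List.Membership.Propositional using (_∈_)
open import Data.List.Membership.Propositional.Properties using (∈-lookup)
open import Data.List.Relation.Unary.All as All using (All; []; _∷_)
open import Data.List.Relation.Unary.All.Properties using (¬Any⇒All¬)
open import Data.List.Relation.Unary.AllPairs using ([]; _∷_)
open import Data.List.Relation.Unary.Any using (here; there; index)
open import Data.List.Relation.Unary.Any.Properties using (lookup-index)
open import Data.List.Relation.Unary.Unique.Propositional using (Unique)
open import Data.Nat using (ℕ; zero; suc; _+_; _∸_; _≤_; _<_; _≤?_; s≤s; s≤s⁻¹)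
import Data.Nat.Properties as ℕ
open import Data.Product as Product using (∃; ∃-syntax; _×_; _,_; proj₁; proj₂)
open import Data.Refinement using (Refinement; _,_; value; proof; value-injective)
open import Data.Sum as Sum using (_⊎_; inj₁; inj₂; swap)
open import Data.Sum.Function.Propositional using (_⊎-↔_)
open import Data.Sum.Properties using (inj₁-injective)
open import Data.Unit using (⊤; tt)
open import Function using (_∘_; id)
open import Function.Bundles using (_⇔_; _↔_; Inverse; mk⇔; mk↔ₛ′)
open import Function.Construct.Composition using (_↔-∘_)
open import Function.Construct.Identity using (↔-id)
open import Function.Construct.Symmetry using (↔-sym)
open import Function.Definitions using (Injective)
open import Relation.Binary.Construct.Closure.ReflexiveTransitive using (Star; ε; _◅_; _◅◅_)
open import Relation.Binary.Definitions using (DecidableEquality)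
open import Relation.Binary.PropositionalEquality using (_≡_; _≢_; refl; sym; trans; cong; cong₂; subst; subst₂)
open import Relation.Nullary using (¬_; Dec; yes; no; contradiction; recompute; ¬?; map′; _×-dec_; _⊎-dec_; decidable-stable)
open import Relation.Unary using (Decidable)
open import Algebra.Properties.CommutativeSemigroup ℕ.+-commutativeSemigroup using (interchange)

-- The floor is a minimum over `H` of a quantity that contains a maximum over paths of `H`.
-- Candidates merge the two into one minimum over pairs of a graph and a path: at a least candidate
-- the path is automatically a longest unique shortest path of its graph. For an arbitrary `H` a
-- parade number is obtained only under a double negation; this suffices, because it serves to prove
-- inequalities between naturals, which are decidable. Colourings survive the pull-back for a simple
-- reason: passing to induced subgraphs drops every edge between the two classes, and a contraction
-- cannot mix colours, since both ends of the contracted edge inherit the colour of their common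
-- image. Sharing `P` between the two classes costs nothing, since a candidate does not count the
-- vertices of its path. The direction from `G` to its two parts has to produce `k₁` and `k₂`. They
-- are the two pieces of a least candidate for `G`, not the result of a search.

private variable
  A B : Set
  m n : ℕ

-- Finite types

Finite : Set → Set
Finite A = ∃[ n ] A ↔ Fin n

to-injective : (A↔B : A ↔ B) → Injective _≡_ _≡_ (Inverse.to A↔B)
to-injective A↔B {x} {y} eq = trans (sym (Inverse.strictlyInverseʳ A↔B x))
  (trans (cong (Inverse.from A↔B) eq) (Inverse.strictlyInverseʳ A↔B y))

≟-via-↔ : A ↔ Fin n → DecidableEquality A
≟-via-↔ A↔Fin x y = map′ (to-injective A↔Fin) (cong (Inverse.to A↔Fin))
  (Inverse.to A↔Fin x Fin.≟ Inverse.to A↔Fin y)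

∃? : A ↔ Fin n → {P : A → Set} → Decidable P → Dec (∃ P)
∃? A↔Fin {P} P? = map′
  (λ (i , p) → Inverse.from A↔Fin i , p)
  (λ (a , p) → Inverse.to A↔Fin a , subst P (sym (Inverse.strictlyInverseʳ A↔Fin a)) p)
  (Fin.any? (P? ∘ Inverse.from A↔Fin))

injective⇒≤ : A ↔ Fin m → B ↔ Fin n → (f : A → B) → Injective _≡_ _≡_ f → m ≤ n
injective⇒≤ A↔Fin B↔Fin f f-injective = Fin.injective⇒≤
  {f = Inverse.to B↔Fin ∘ f ∘ Inverse.from A↔Fin}
  (to-injective (↔-sym A↔Fin) ∘ f-injective ∘ to-injective B↔Fin)

-- `Refinement` holds its proof irrelevantly, so an element is determined by its value. A vertex
-- that satisfies a disjunction such as `ColouredOrOn` in two ways is thus counted once.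
finite-refinement-Fin : ∀ n (P : Fin n → Set) → Decidable P → Finite (Refinement (Fin n) P)
finite-refinement-Fin zero P P? = 0 , mk↔ₛ′ value (λ ()) (λ ()) (λ ())
finite-refinement-Fin (suc n) P P?
  with P? zero | finite-refinement-Fin n (P ∘ suc) (P? ∘ suc)
... | yes p | m , bij = suc m , mk↔ₛ′ to from to∘from from∘to
  where
  to : Refinement (Fin (suc n)) P → Fin (suc m)
  to (zero  , _) = zero
  to (suc i , q) = suc (Inverse.to bij (i , q))
  shift : Refinement (Fin n) (P ∘ suc) → Refinement (Fin (suc n)) P
  shift (i , q) = suc i , q
  from : Fin (suc m) → Refinement (Fin (suc n)) P
  from zero    = zero , [ p ]
  from (suc j) = shift (Inverse.from bij j)
  to∘from : ∀ j → to (from j) ≡ j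
  to∘from zero    = refl
  to∘from (suc j) = cong suc (Inverse.strictlyInverseˡ bij j)
  from∘to : ∀ i → from (to i) ≡ i
  from∘to (zero  , _) = refl
  from∘to (suc i , q) = cong shift (Inverse.strictlyInverseʳ bij (i , q))
... | no ¬p | m , bij = m , mk↔ₛ′ to from to∘from from∘to
  where
  to : Refinement (Fin (suc n)) P → Fin m
  to (zero  , [ p ]) = ⊥-elim (recompute (no id) (¬p p))
  to (suc i , q)     = Inverse.to bij (i , q)
  shift : Refinement (Fin n) (P ∘ suc) → Refinement (Fin (suc n)) P
  shift (i , q) = suc i , q
  from : Fin m → Refinement (Fin (suc n)) P
  from j = shift (Inverse.from bij j)
  to∘from : ∀ j → to (from j) ≡ j
  to∘from j = Inverse.strictlyInverseˡ bij j
  from∘to : ∀ i → from (to i) ≡ i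
  from∘to (zero  , [ p ]) = ⊥-elim (recompute (no id) (¬p p))
  from∘to (suc i , q)     = cong shift (Inverse.strictlyInverseʳ bij (i , q))

finite-refinement : A ↔ Fin n → {P : A → Set} → Decidable P → Finite (Refinement A P)
finite-refinement {n = n} A↔Fin {P} P?
  with m , bij ← finite-refinement-Fin n (P ∘ Inverse.from A↔Fin) (P? ∘ Inverse.from A↔Fin)
  = m , bij ↔-∘ mk↔ₛ′
    (λ (a , p) → Inverse.to A↔Fin a , Irrelevant.map (subst P (sym (Inverse.strictlyInverseʳ A↔Fin a))) p)
    (λ (i , p) → Inverse.from A↔Fin i , p)
    (λ (i , _) → value-injective (Inverse.strictlyInverseˡ A↔Fin i))
    (λ (a , _) → value-injective (Inverse.strictlyInverseʳ A↔Fin a))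

-- Subgraphs as minors

source target : (G : Graph) → E G → V G
source G = proj₁ ∘ ends G
target G = proj₂ ∘ ends G

module _ (G : Graph) where

  joins-ends : ∀ e → Joins G e (source G e) (target G e)
  joins-ends e = inj₁ refl

  joins-unique : ∀ {e a b x y} → Joins G e a b → Joins G e x y →
                 (a ≡ x × b ≡ y) ⊎ (a ≡ y × b ≡ x)
  joins-unique (inj₁ p) (inj₁ q) with refl ← trans (sym p) q = inj₁ (refl , refl)
  joins-unique (inj₁ p) (inj₂ q) with refl ← trans (sym p) q = inj₂ (refl , refl)
  joins-unique (inj₂ p) (inj₁ q) with refl ← trans (sym p) q = inj₂ (refl , refl)
  joins-unique (inj₂ p) (inj₂ q) with refl ← trans (sym p) q = inj₁ (refl , refl)

  joins-resp : ∀ {e a b x y} → Joins G e a b → (a ≡ x × b ≡ y) ⊎ (a ≡ y × b ≡ x) → Joins G e x y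
  joins-resp j (inj₁ (refl , refl)) = j
  joins-resp j (inj₂ (refl , refl)) = swap j

  BothEnds : (V G → Set) → E G → Set
  BothEnds S e = S (source G e) × S (target G e)

  bothEnds⁺ : ∀ (S : V G → Set) {e x y} → Joins G e x y → S x → S y → BothEnds S e
  bothEnds⁺ S (inj₁ p) sx sy = subst (S ∘ proj₁) (sym p) sx , subst (S ∘ proj₂) (sym p) sy
  bothEnds⁺ S (inj₂ p) sx sy = subst (S ∘ proj₁) (sym p) sy , subst (S ∘ proj₂) (sym p) sx

  bothEnds⁻ : ∀ (S : V G → Set) {e x y} → Joins G e x y → BothEnds S e → S x × S y
  bothEnds⁻ S (inj₁ p) (s , t) = subst (S ∘ proj₁) p s , subst (S ∘ proj₂) p t
  bothEnds⁻ S (inj₂ p) (s , t) = subst (S ∘ proj₂) p t , subst (S ∘ proj₁) p s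

-- Injectivity on edges keeps parallel edges distinct. The image is a subgraph, not necessarily an
-- induced one.
record Embedding (G H : Graph) : Set where
  field
    onV         : V G → V H
    onE         : E G → E H
    onV-injective : Injective _≡_ _≡_ onV
    onE-injective : Injective _≡_ _≡_ onE
    preserves   : ∀ e u v → Joins G e u v → Joins H (onE e) (onV u) (onV v)

_∘ₑ_ : ∀ {G H K} → Embedding H K → Embedding G H → Embedding G K
g ∘ₑ f = record
  { onV = g.onV ∘ f.onV
  ; onE = g.onE ∘ f.onE
  ; onV-injective = f.onV-injective ∘ g.onV-injective
  ; onE-injective = f.onE-injective ∘ g.onE-injective
  ; preserves = λ e u v → g.preserves _ _ _ ∘ f.preserves e u v
  } where module f = Embedding f; module g = Embedding g

≅⇒embedding : ∀ {G H} → G ≅ H → Embedding G H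
≅⇒embedding iso = record
  { onV = Inverse.to onV
  ; onE = Inverse.to onE
  ; onV-injective = to-injective onV
  ; onE-injective = to-injective onE
  ; preserves = preserves
  } where open _≅_ iso

-- Incidence is reflected as well: an edge has a single unordered pair of ends, so the ends of its
-- preimage must map to the given ones.
≅-sym : ∀ {G H} → G ≅ H → H ≅ G
≅-sym {G} {H} iso = record
  { onV = ↔-sym onV
  ; onE = ↔-sym onE
  ; preserves = λ e u v j → joins-resp G (joins-ends G (from onE e))
      (move (joins-unique H (preserves _ _ _ (joins-ends G (from onE e)))
        (subst (λ e → Joins H e u v) (sym (Inverse.strictlyInverseˡ onE e)) j)))
  }
  where
  open _≅_ iso
  open Inverse
  cancel : ∀ {a x} → to onV a ≡ x → a ≡ from onV x
  cancel refl = sym (Inverse.strictlyInverseʳ onV _)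
  move : ∀ {a b x y} → (to onV a ≡ x × to onV b ≡ y) ⊎ (to onV a ≡ y × to onV b ≡ x) →
         (a ≡ from onV x × b ≡ from onV y) ⊎ (a ≡ from onV y × b ≡ from onV x)
  move (inj₁ (p , q)) = inj₁ (cancel p , cancel q)
  move (inj₂ (p , q)) = inj₂ (cancel p , cancel q)

module _ (H : Graph) {S : V H → Set} (S? : Decidable S) {F : E H → Set} (F? : Decidable F)
         (closed : ∀ {e} → F e → BothEnds H S e) (x₀ : Refinement (V H) S) where

  subgraph : Graph
  subgraph = record
    { V = Refinement (V H) S
    ; E = Refinement (E H) F
    ; order = proj₁ (finite-refinement (V↔Fin H) S?)
    ; size = proj₁ (finite-refinement (E↔Fin H) F?)
    ; V↔Fin = proj₂ (finite-refinement (V↔Fin H) S?)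
    ; E↔Fin = proj₂ (finite-refinement (E↔Fin H) F?)
    ; nonempty = x₀
    ; ends = λ e → (source H (value e) , Irrelevant.map (proj₁ ∘ closed) (proof e))
                 , (target H (value e) , Irrelevant.map (proj₂ ∘ closed) (proof e))
    ; loopless = λ e → loopless H (value e) ∘ cong value
    }

  subgraph-joins⁻ : ∀ e x y → Joins subgraph e x y → Joins H (value e) (value x) (value y)
  subgraph-joins⁻ e x y (inj₁ refl) = inj₁ refl
  subgraph-joins⁻ e x y (inj₂ refl) = inj₂ refl

  subgraph-joins⁺ : ∀ e x y → Joins H (value e) (value x) (value y) → Joins subgraph e x y
  subgraph-joins⁺ e x y (inj₁ p) =
    inj₁ (cong₂ _,_ (value-injective (cong proj₁ p)) (value-injective (cong proj₂ p)))
  subgraph-joins⁺ e x y (inj₂ p) =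
    inj₂ (cong₂ _,_ (value-injective (cong proj₁ p)) (value-injective (cong proj₂ p)))

  subgraph-embedding : Embedding subgraph H
  subgraph-embedding = record
    { onV = value
    ; onE = value
    ; onV-injective = value-injective
    ; onE-injective = value-injective
    ; preserves = subgraph-joins⁻
    }

  corestrict : ∀ {G} (i : Embedding G H) → (∀ x → S (Embedding.onV i x)) →
               (∀ e → F (Embedding.onE i e)) → Embedding G subgraph
  corestrict i inS inF = record
    { onV = λ x → onV x , [ inS x ]
    ; onE = λ e → onE e , [ inF e ]
    ; onV-injective = onV-injective ∘ cong value
    ; onE-injective = onE-injective ∘ cong value
    ; preserves = λ e u v j → subgraph-joins⁺ (onE e , [ inF e ]) _ _ (preserves e u v j)
    } where open Embedding i

value≢ : ∀ {A : Set} {P : A → Set} {b} (r : Refinement A P) → ¬ P b → value r ≢ b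
value≢ (_ , [ p ]) ¬Pb refl = ⊥-elim (recompute (no id) (¬Pb p))

≢? : ∀ {A : Set} {n} → A ↔ Fin n → (b : A) → Decidable (_≢ b)
≢? A↔Fin b a = ¬? (≟-via-↔ A↔Fin a b)

refinement-≃-∖ : ∀ {A : Set} {b : A} → Refinement A (_≢ b) ≃ A ∖ b
refinement-≃-∖ = record
  { to = value
  ; injective = value-injective
  ; avoids = λ r → value≢ r (λ b≢b → b≢b refl)
  ; covers = λ x x≢b → (x , [ x≢b ]) , refl
  }

refinement-⊤-↔ : ∀ {A : Set} → Refinement A (λ _ → ⊤) ↔ A
refinement-⊤-↔ = mk↔ₛ′ value (λ a → a , [ tt ]) (λ _ → refl) (λ _ → refl)

-- Pigeonhole: `b` together with the elements of the refinement injects into `A`.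
finite-refinement-< : ∀ {A : Set} {n P} (A↔Fin : A ↔ Fin n) (P? : Decidable P) (b : A) → ¬ P b →
                      proj₁ (finite-refinement A↔Fin {P} P?) < n
finite-refinement-< {A} {n} {P} A↔Fin P? b ¬Pb = Fin.injective⇒≤ {f = f} f-injective
  where
  B↔Fin = proj₂ (finite-refinement A↔Fin P?)
  g : Fin _ → A
  g = value ∘ Inverse.from B↔Fin
  f : Fin (suc _) → Fin n
  f zero    = Inverse.to A↔Fin b
  f (suc i) = Inverse.to A↔Fin (g i)
  g≢b : ∀ {i} → g i ≢ b
  g≢b {i} = value≢ (Inverse.from B↔Fin i) ¬Pb
  f-injective : Injective _≡_ _≡_ f
  f-injective {zero}  {zero}  eq = refl
  f-injective {zero}  {suc j} eq = contradiction (sym (to-injective A↔Fin eq)) (g≢b {j})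
  f-injective {suc i} {zero}  eq = contradiction (to-injective A↔Fin eq) (g≢b {i})
  f-injective {suc i} {suc j} eq =
    cong suc (to-injective (↔-sym B↔Fin) (value-injective (to-injective A↔Fin eq)))

finite-refinement-≤ : ∀ {A : Set} {n P} (A↔Fin : A ↔ Fin n) (P? : Decidable P) →
                      proj₁ (finite-refinement A↔Fin {P} P?) ≤ n
finite-refinement-≤ A↔Fin P? =
  injective⇒≤ (proj₂ (finite-refinement A↔Fin P?)) A↔Fin value value-injective

-- The trivial predicate lets both deletions be instances of `subgraph`: one of the two sets is kept
-- whole while the other loses an element.
yes-tt : ∀ {A : Set} → Decidable {A = A} (λ _ → ⊤)
yes-tt _ = yes tt

module _ (H : Graph) (f : E H) where

  _∖ᴱ_ : Graph
  _∖ᴱ_ = subgraph H yes-tt (≢? (E↔Fin H) f) (λ _ → tt , tt) (nonempty H , [ tt ])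

  delete-edge : H ⟶ _∖ᴱ_
  delete-edge = deleteEdge record
    { deleted = f
    ; onV = refinement-⊤-↔
    ; onE = refinement-≃-∖
    ; preserves = λ e x y → λ { (inj₁ refl) → inj₁ refl ; (inj₂ refl) → inj₂ refl }
    }

module _ (H : Graph) (v : V H) (isolated : ∀ e u → ¬ Joins H e v u) (x₀ : Refinement (V H) (_≢ v)) where

  deletion-closed : ∀ {e} → ⊤ → BothEnds H (_≢ v) e
  deletion-closed {e} _ = (λ { refl → isolated e _ (inj₁ refl) }) , (λ { refl → isolated e _ (inj₂ refl) })

  _∖ⱽ_ : Graph
  _∖ⱽ_ = subgraph H (≢? (V↔Fin H) v) yes-tt
    deletion-closed x₀

  delete-vertex : H ⟶ _∖ⱽ_
  delete-vertex = deleteVertex record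
    { deleted = v
    ; isolated = isolated
    ; onV = refinement-≃-∖
    ; onE = refinement-⊤-↔
    ; preserves = λ e x y → λ { (inj₁ refl) → inj₁ refl ; (inj₂ refl) → inj₂ refl }
    }

surjective? : ∀ {A B : Set} {m n} → A ↔ Fin m → B ↔ Fin n → (f : A → B) →
              (∃[ b ] ∀ a → f a ≢ b) ⊎ (∀ b → ∃[ a ] f a ≡ b)
surjective? A↔Fin B↔Fin f with ∃? B↔Fin (λ b → ¬? (∃? A↔Fin (λ a → ≟-via-↔ B↔Fin (f a) b)))
... | yes (b , missed) = inj₁ (b , λ a eq → missed (a , eq))
... | no  none = inj₂ λ b → decidable-stable (∃? A↔Fin (λ a → ≟-via-↔ B↔Fin (f a) b)) (λ ¬p → none (b , ¬p))

bijective⇒↔ : ∀ {A B : Set} (f : A → B) → Injective _≡_ _≡_ f → (∀ b → ∃[ a ] f a ≡ b) → A ↔ B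
bijective⇒↔ f inj surj = mk↔ₛ′ f (proj₁ ∘ surj) (proj₂ ∘ surj) (λ a → inj (proj₂ (surj (f a))))

infixr 5 _◅ₘ_
_◅ₘ_ : ∀ {G H K} → H ⟶ K → G IsMinorOf K → G IsMinorOf H
s ◅ₘ (K , ss , iso) = K , s ◅ ss , iso

-- Edges outside the image are deleted before vertices. Once every edge comes from `G`, a vertex
-- outside the image is isolated and may be deleted; once nothing is missed, the embedding is an
-- isomorphism. The fuel `n` bounds order plus size, which drops with each deletion.
embedding⇒minor : ∀ {G H} → Embedding G H → G IsMinorOf H
embedding⇒minor {G} {H} = go H _ ℕ.≤-refl
  where
  go : ∀ H n → order H + size H < n → Embedding G H → G IsMinorOf H
  go H (suc n) bound i with surjective? (E↔Fin G) (E↔Fin H) (Embedding.onE i)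
                          | surjective? (V↔Fin G) (V↔Fin H) (Embedding.onV i)
  ... | inj₁ (f , missed) | _ =
    delete-edge H f ◅ₘ
      go (H ∖ᴱ f) n (ℕ.≤-trans smaller (s≤s⁻¹ bound)) (corestrict H yes-tt (≢? (E↔Fin H) f) (λ _ → tt , tt) _ i (λ _ → tt) missed)
    where
    smaller : order (H ∖ᴱ f) + size (H ∖ᴱ f) < order H + size H
    smaller = ℕ.+-mono-≤-< (finite-refinement-≤ (V↔Fin H) yes-tt)
                           (finite-refinement-< (E↔Fin H) (≢? (E↔Fin H) f) f (λ f≢f → f≢f refl))
  ... | inj₂ onto | inj₁ (v , missed) =
    delete-vertex H v isolated x₀ ◅ₘ
      go H∖v n (ℕ.≤-trans smaller (s≤s⁻¹ bound)) (corestrict H (≢? (V↔Fin H) v) yes-tt (deletion-closed H v isolated x₀) x₀ i missed (λ _ → tt))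
    where
    isolated : ∀ e u → ¬ Joins H e v u
    isolated e u j with e′ , refl ← onto e
      with joins-unique H (Embedding.preserves i _ _ _ (joins-ends G e′)) j
    ... | inj₁ (p , _) = missed _ p
    ... | inj₂ (_ , p) = missed _ p
    x₀ : Refinement (V H) (_≢ v)
    x₀ = Embedding.onV i (nonempty G) , [ missed _ ]
    H∖v = _∖ⱽ_ H v isolated x₀
    smaller : order H∖v + size H∖v < order H + size H
    smaller = ℕ.+-mono-<-≤ (finite-refinement-< (V↔Fin H) (≢? (V↔Fin H) v) v (λ v≢v → v≢v refl))
                           (finite-refinement-≤ (E↔Fin H) yes-tt)
  ... | inj₂ ontoE | inj₂ ontoV = H , ε , ≅-sym record
    { onV = bijective⇒↔ (Embedding.onV i) (Embedding.onV-injective i) ontoV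
    ; onE = bijective⇒↔ (Embedding.onE i) (Embedding.onE-injective i) ontoE
    ; preserves = Embedding.preserves i
    }

-- Pulling a colouring back along minor operations

≅-trans : ∀ {G H K} → G ≅ H → H ≅ K → G ≅ K
≅-trans f g = record
  { onV = g.onV ↔-∘ f.onV
  ; onE = g.onE ↔-∘ f.onE
  ; preserves = λ e u v → g.preserves _ _ _ ∘ f.preserves e u v
  } where module f = _≅_ f; module g = _≅_ g

≅-refl : ∀ {G} → G ≅ G
≅-refl = record { onV = ↔-id _ ; onE = ↔-id _ ; preserves = λ _ _ _ → id }

minor-refl : ∀ {G} → G IsMinorOf G
minor-refl = _ , ε , ≅-refl

≃∖-↔ : ∀ {A B C : Set} {b} → A ≃ B ∖ b → (B↔C : B ↔ C) → A ≃ C ∖ Inverse.to B↔C b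
≃∖-↔ A≃B∖b B↔C = record
  { to = Inverse.to B↔C ∘ to
  ; injective = injective ∘ to-injective B↔C
  ; avoids = λ a → avoids a ∘ to-injective B↔C
  ; covers = λ x x≢b →
      let a , eq = covers (Inverse.from B↔C x) λ eq →
                     x≢b (trans (sym (Inverse.strictlyInverseˡ B↔C x)) (cong (Inverse.to B↔C) eq))
      in a , trans (cong (Inverse.to B↔C) eq) (Inverse.strictlyInverseˡ B↔C x)
  } where open _≃_∖_ A≃B∖b

-- Minors are defined up to isomorphism, so to compose two of them the steps of one must be made to
-- start at an isomorphic copy.
≅-⟶ : ∀ {H K L} → H ≅ K → K ⟶ L → H ⟶ L
≅-⟶ {H} {K} iso step = case step
  where
  module σ = _≅_ iso
  module τ = _≅_ (≅-sym iso)
  σV = Inverse.to σ.onV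
  τV = Inverse.to τ.onV
  στ : ∀ x → σV (τV x) ≡ x
  στ = Inverse.strictlyInverseˡ σ.onV
  τσ : ∀ x → τV (σV x) ≡ x
  τσ = Inverse.strictlyInverseʳ σ.onV
  σ≡⇒≡τ : ∀ {x y} → σV x ≡ y → x ≡ τV y
  σ≡⇒≡τ refl = sym (τσ _)
  case : ∀ {L} → K ⟶ L → H ⟶ L
  case (deleteVertex d) = deleteVertex record
    { deleted = τV deleted
    ; isolated = λ e u j → isolated _ _ (subst (λ x → Joins K _ x (σV u)) (στ deleted) (σ.preserves e _ u j))
    ; onV = ≃∖-↔ onV τ.onV
    ; onE = τ.onE ↔-∘ onE
    ; preserves = λ e x y → τ.preserves _ _ _ ∘ preserves e x y
    } where open VertexDeletion d
  case (deleteEdge d) = deleteEdge record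
    { deleted = Inverse.to τ.onE deleted
    ; onV = τ.onV ↔-∘ onV
    ; onE = ≃∖-↔ onE τ.onE
    ; preserves = λ e x y → τ.preserves _ _ _ ∘ preserves e x y
    } where open EdgeDeletion d
  case (contractEdge c) = contractEdge record
    { contracted = Inverse.to τ.onE contracted
    ; u = τV u
    ; v = τV v
    ; joins = τ.preserves _ _ _ joins
    ; noParallel = λ f j →
        trans (sym (Inverse.strictlyInverseʳ σ.onE f))
          (cong (Inverse.from σ.onE)
            (noParallel _ (subst₂ (Joins K _) (στ u) (στ v) (σ.preserves _ _ _ j))))
    ; quotient = quotient ∘ σV
    ; surjective = λ y → let x , qx≡y = surjective y in
        τV x , λ { refl → qx≡y (στ x) }
    ; identifies = trans (cong quotient (στ u)) (trans identifies (cong quotient (sym (στ v))))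
    ; separates = λ x y eq → sep (separates (σV x) (σV y) eq)
    ; onE = ≃∖-↔ onE τ.onE
    ; preserves = λ f x y j → preserves f (σV x) (σV y)
        (subst (λ e → Joins K e (σV x) (σV y)) (Inverse.strictlyInverseˡ σ.onE _) (σ.preserves _ x y j))
    }
    where
    open Contraction c
    sep : ∀ {x y} → σV x ≡ σV y ⊎ (σV x ≡ u × σV y ≡ v) ⊎ (σV x ≡ v × σV y ≡ u) →
          x ≡ y ⊎ (x ≡ τV u × y ≡ τV v) ⊎ (x ≡ τV v × y ≡ τV u)
    sep (inj₁ eq)             = inj₁ (to-injective σ.onV eq)
    sep (inj₂ (inj₁ (p , q))) = inj₂ (inj₁ (σ≡⇒≡τ p , σ≡⇒≡τ q))
    sep (inj₂ (inj₂ (p , q))) = inj₂ (inj₂ (σ≡⇒≡τ p , σ≡⇒≡τ q))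

≅-minor : ∀ {G H K} → G IsMinorOf K → H ≅ K → G IsMinorOf H
≅-minor (_ , ε , K≅G) H≅K             = _ , ε , ≅-trans H≅K K≅G
≅-minor (_ , step ◅ steps , K′≅G) H≅K = _ , ≅-⟶ H≅K step ◅ steps , K′≅G

minor-trans : ∀ {G H K} → G IsMinorOf K → K IsMinorOf H → G IsMinorOf H
minor-trans G≼K (K′ , steps , K′≅K) =
  let G′ , steps′ , G′≅G = ≅-minor G≼K K′≅K in G′ , steps ◅◅ steps′ , G′≅G

module _ (H : Graph) {S : V H → Set} (S? : Decidable S) where

  bothEnds? : Decidable (BothEnds H S)
  bothEnds? e = S? (source H e) ×-dec S? (target H e)

  induced : Refinement (V H) S → Graph
  induced = subgraph H S? bothEnds? id

  corestrict-induced : ∀ x₀ {G} (i : Embedding G H) → (∀ x → S (Embedding.onV i x)) →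
                       Embedding G (induced x₀)
  corestrict-induced x₀ {G} i inS = corestrict H S? bothEnds? id x₀ i inS λ e →
    bothEnds⁺ H S (Embedding.preserves i _ _ _ (joins-ends G e)) (inS _) (inS _)

induced-embedding : ∀ {G H} (i : Embedding G H) {S : V G → Set} (S? : Decidable S) {T : V H → Set} (T? : Decidable T) →
                    (∀ x → S x → T (Embedding.onV i x)) →
                    ∀ x₀ y₀ → Embedding (induced G S? x₀) (induced H T? y₀)
induced-embedding {G} {H} i S? T? S⇒T x₀ y₀ =
  corestrict-induced H T? y₀ (i ∘ₑ subgraph-embedding G S? (bothEnds? G S?) id x₀)
    -- `s` is irrelevant, while `corestrict-induced` asks for a relevant proof; decidability of `T`
    -- restores one.
    λ (x , [ s ]) → recompute (T? (Embedding.onV i x)) (S⇒T x s)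

module _ (H : Graph) (c : V H → Bool) (b : Bool) where

  colour? : Decidable (λ x → c x ≡ b)
  colour? x = c x Bool.≟ b

  colourClass : Refinement (V H) (λ x → c x ≡ b) → Graph
  colourClass = induced H colour?

  colourClass-joins⁻ : ∀ x₀ e x y → Joins (colourClass x₀) e x y → Joins H (value e) (value x) (value y)
  colourClass-joins⁻ = subgraph-joins⁻ H colour? (bothEnds? H colour?) id

  colourClass-joins⁺ : ∀ x₀ e x y → Joins H (value e) (value x) (value y) → Joins (colourClass x₀) e x y
  colourClass-joins⁺ = subgraph-joins⁺ H colour? (bothEnds? H colour?) id

-- The colouring `c′` is arbitrary, and edges may run between the two classes. Base points accompany
-- the classes because a graph has at least one vertex: a vertex of a class in `H′` must yield one
-- of that class in `H`.
record ColourLift (H H′ : Graph) (c′ : V H′ → Bool) : Set₁ where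
  field
    colour : V H → Bool
    lift   : ∀ b x′ → ∃[ x ] (colourClass H′ c′ b x′ IsMinorOf colourClass H colour b x)

embedding-colourLift : ∀ {H H′} (i : Embedding H′ H) (c : V H → Bool) (c′ : V H′ → Bool) →
                       (∀ x → c (Embedding.onV i x) ≡ c′ x) → ColourLift H H′ c′
embedding-colourLift {H} {H′} i c c′ agree = record
  { colour = c
  ; lift = λ b (x , [ s ]) →
      (Embedding.onV i x , [ trans (agree x) s ]) ,
      embedding⇒minor (induced-embedding i (colour? H′ c′ b) (colour? H c b) (λ x → trans (agree x)) _ _)
  }

vertexDeletion⇒embedding : ∀ {H G} → VertexDeletion H G → Embedding G H
vertexDeletion⇒embedding d = record
  { onV = _≃_∖_.to onV
  ; onE = Inverse.to onE
  ; onV-injective = _≃_∖_.injective onV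
  ; onE-injective = to-injective onE
  ; preserves = preserves
  } where open VertexDeletion d

edgeDeletion⇒embedding : ∀ {H G} → EdgeDeletion H G → Embedding G H
edgeDeletion⇒embedding d = record
  { onV = Inverse.to onV
  ; onE = _≃_∖_.to onE
  ; onV-injective = to-injective onV
  ; onE-injective = _≃_∖_.injective onE
  ; preserves = preserves
  } where open EdgeDeletion d

vertexDeletion-colourLift : ∀ {H H′} → VertexDeletion H H′ → ∀ c′ → ColourLift H H′ c′
vertexDeletion-colourLift {H} {H′} d c′ =
  embedding-colourLift (vertexDeletion⇒embedding d) c c′ agree
  where
  open VertexDeletion d
  open _≃_∖_ onV
  c : V H → Bool
  c x with ≟-via-↔ (V↔Fin H) x deleted
  -- The colour of the deleted vertex is an arbitrary choice: an extra vertex in either class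
  -- preserves the embedding of the classes.
  ... | yes _         = true
  ... | no x≢deleted = c′ (proj₁ (covers x x≢deleted))
  agree : ∀ x → c (to x) ≡ c′ x
  agree x with ≟-via-↔ (V↔Fin H) (to x) deleted
  ... | yes eq = contradiction eq (avoids x)
  ... | no ≢   = cong c′ (injective (proj₂ (covers (to x) ≢)))

edgeDeletion-colourLift : ∀ {H H′} → EdgeDeletion H H′ → ∀ c′ → ColourLift H H′ c′
edgeDeletion-colourLift d c′ =
  embedding-colourLift (edgeDeletion⇒embedding d) (c′ ∘ Inverse.from onV) c′
    (cong c′ ∘ Inverse.strictlyInverseʳ onV)
  where open EdgeDeletion d

module _ {H H′} (k : Contraction H H′) (c′ : V H′ → Bool) (b : Bool) where
  open Contraction k
  open _≃_∖_ onE renaming (to to toE)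

  private
    c : V H → Bool
    c = c′ ∘ quotient

    toE-joins : ∀ f → Joins H′ f (quotient (source H (toE f))) (quotient (target H (toE f)))
    toE-joins f = preserves f _ _ (joins-ends H (toE f))

    toE-ends : ∀ f → BothEnds H′ (λ x → c′ x ≡ b) f → BothEnds H (λ x → c x ≡ b) (toE f)
    toE-ends f = bothEnds⁻ H′ (λ x → c′ x ≡ b) (toE-joins f)

  -- Both ends of the contracted edge have the colour of their common image, so the edge lies in
  -- class `b` and the contraction restricts to that class.
  contraction-inside : c u ≡ b → ∀ x₀ y₀ → Contraction (colourClass H c b x₀) (colourClass H′ c′ b y₀)
  contraction-inside cu≡b x₀ y₀ = record
    { contracted = contracted , [ bothEnds⁺ H (λ x → c x ≡ b) joins cu≡b cv≡b ]
    ; u = u , [ cu≡b ]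
    ; v = v , [ cv≡b ]
    ; joins = colourClass-joins⁺ H c b x₀ (contracted , [ bothEnds⁺ H (λ x → c x ≡ b) joins cu≡b cv≡b ]) _ _ joins
    ; noParallel = λ f j → value-injective (noParallel _ (colourClass-joins⁻ H c b x₀ f _ _ j))
    ; quotient = λ (x , s) → quotient x , s
    ; surjective = λ (y , s) → let x , qx≡y = surjective y in
        (x , Irrelevant.map (trans (cong c′ (qx≡y refl))) s) , λ { refl → value-injective (qx≡y refl) }
    ; identifies = value-injective identifies
    ; separates = λ x y eq → sep (separates (value x) (value y) (cong value eq))
    ; onE = record
      { to = λ (f , s) → toE f , Irrelevant.map (toE-ends f) s
      ; injective = λ eq → value-injective (injective (cong value eq))
      ; avoids = λ (f , _) eq → avoids f (cong value eq)
      ; covers = λ (f , s) f≢ → let f′ , eq = covers f (f≢ ∘ value-injective) in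
          (f′ , Irrelevant.map (λ ss → fromE-ends f′ (subst (BothEnds H (λ x → c x ≡ b)) (sym eq) ss)) s)
          , value-injective eq
      }
    ; preserves = λ (f , s) x y j → colourClass-joins⁺ H′ c′ b y₀ (f , s) _ _
        (preserves f _ _ (colourClass-joins⁻ H c b x₀ (toE f , Irrelevant.map (toE-ends f) s) x y j))
    }
    where
    cv≡b : c v ≡ b
    cv≡b = trans (cong c′ (sym identifies)) cu≡b
    fromE-ends : ∀ f → BothEnds H (λ x → c x ≡ b) (toE f) → BothEnds H′ (λ x → c′ x ≡ b) f
    fromE-ends f (s , t) = bothEnds⁺ H′ (λ x → c′ x ≡ b) (toE-joins f) s t
    sep : ∀ {x y : Refinement (V H) (λ x → c x ≡ b)} →
          value x ≡ value y ⊎ (value x ≡ u × value y ≡ v) ⊎ (value x ≡ v × value y ≡ u) →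
          x ≡ y ⊎ (x ≡ (u , [ cu≡b ]) × y ≡ (v , [ cv≡b ])) ⊎ (x ≡ (v , [ cv≡b ]) × y ≡ (u , [ cu≡b ]))
    sep (inj₁ eq)             = inj₁ (value-injective eq)
    sep (inj₂ (inj₁ (p , q))) = inj₂ (inj₁ (value-injective p , value-injective q))
    sep (inj₂ (inj₂ (p , q))) = inj₂ (inj₂ (value-injective p , value-injective q))

  section : Refinement (V H′) (λ x → c′ x ≡ b) → Refinement (V H) (λ x → c x ≡ b)
  section (y , s) = let x , qx≡y = surjective y in x , Irrelevant.map (trans (cong c′ (qx≡y refl))) s

  -- The two identified vertices both lie in the other class, so the quotient is injective on class
  -- `b`, and choosing preimages embeds the smaller class in the larger.
  contraction-outside : c u ≢ b → ∀ x₀ y₀ → Embedding (colourClass H′ c′ b y₀) (colourClass H c b x₀)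
  contraction-outside cu≢b x₀ y₀ = record
    { onV = section
    ; onE = λ (f , s) → toE f , Irrelevant.map (toE-ends f) s
    ; onV-injective = λ {x} {y} eq → value-injective
        (trans (sym (proj₂ (surjective (value x)) refl))
          (trans (cong (quotient ∘ value) eq) (proj₂ (surjective (value y)) refl)))
    ; onE-injective = λ eq → value-injective (injective (cong value eq))
    ; preserves = λ (f , s) x y j → colourClass-joins⁺ H c b x₀ (toE f , Irrelevant.map (toE-ends f) s) _ _
        (joins-resp H (joins-ends H (toE f))
          (move x y (joins-unique H′ (toE-joins f) (colourClass-joins⁻ H′ c′ b y₀ (f , s) x y j))))
    }
    where
    unique-preimage : ∀ a (x : Refinement (V H′) (λ x → c′ x ≡ b)) → quotient a ≡ value x → a ≡ value (section x)
    unique-preimage a (x , [ s ]) qa≡x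
      with separates a (proj₁ (surjective x)) (trans qa≡x (sym (proj₂ (surjective x) refl)))
    ... | inj₁ eq = eq
    -- A second preimage would make `a` an end of the contracted edge, and such an end has the wrong
    -- colour.
    ... | inj₂ (inj₁ (refl , _)) = contradiction (trans (cong c′ qa≡x) (recompute (c′ x Bool.≟ b) s)) cu≢b
    ... | inj₂ (inj₂ (refl , _)) = contradiction
      (trans (cong c′ (trans identifies qa≡x)) (recompute (c′ x Bool.≟ b) s)) cu≢b
    move : ∀ {a d} x y → (quotient a ≡ value x × quotient d ≡ value y) ⊎ (quotient a ≡ value y × quotient d ≡ value x) →
           (a ≡ value (section x) × d ≡ value (section y)) ⊎ (a ≡ value (section y) × d ≡ value (section x))
    move x y (inj₁ (p , q)) = inj₁ (unique-preimage _ x p , unique-preimage _ y q)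
    move x y (inj₂ (p , q)) = inj₂ (unique-preimage _ y p , unique-preimage _ x q)

contraction-colourLift : ∀ {H H′} → Contraction H H′ → ∀ c′ → ColourLift H H′ c′
contraction-colourLift {H} {H′} k c′ = record
  { colour = c′ ∘ quotient
  ; lift = λ b x′ → section k c′ b x′ , minor b x′
  }
  where
  open Contraction k
  minor : ∀ b x′ → colourClass H′ c′ b x′ IsMinorOf colourClass H (c′ ∘ quotient) b (section k c′ b x′)
  minor b x′ with c′ (quotient u) Bool.≟ b
  ... | yes cu≡b = contractEdge (contraction-inside k c′ b cu≡b _ _) ◅ₘ minor-refl
  ... | no cu≢b  = embedding⇒minor (contraction-outside k c′ b cu≢b (section k c′ b x′) _)

⟶-colourLift : ∀ {H H′} → H ⟶ H′ → ∀ c′ → ColourLift H H′ c′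
⟶-colourLift (deleteVertex d) = vertexDeletion-colourLift d
⟶-colourLift (deleteEdge d)   = edgeDeletion-colourLift d
⟶-colourLift (contractEdge k) = contraction-colourLift k

-- Colours travel against the steps: the colouring obtained from the tail is the input for the first
-- step.
star-colourLift : ∀ {H H′} → Star _⟶_ H H′ → ∀ c′ → ColourLift H H′ c′
star-colourLift ε c′ = record
  { colour = c′ ; lift = λ b x → x , minor-refl }
star-colourLift (step ◅ steps) c′ = record
  { colour = ColourLift.colour first
  ; lift = λ b x′ →
      let y , minor₂ = ColourLift.lift rest b x′
          x , minor₁ = ColourLift.lift first b y
      in x , minor-trans minor₂ minor₁
  }
  where
  rest = star-colourLift steps c′
  first = ⟶-colourLift step (ColourLift.colour rest)

-- Unique shortest paths

unique⇒lookup-injective : ∀ {A : Set} {xs : List A} → Unique xs → Injective _≡_ _≡_ (lookup xs)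
unique⇒lookup-injective (x∉xs ∷ _) {zero} {zero} eq = refl
unique⇒lookup-injective (x∉xs ∷ _) {zero} {suc j} eq = contradiction eq (All.lookup x∉xs (∈-lookup j))
unique⇒lookup-injective (x∉xs ∷ _) {suc i} {zero} eq = contradiction (sym eq) (All.lookup x∉xs (∈-lookup i))
unique⇒lookup-injective (_ ∷ uniq) {suc i} {suc j} eq = cong suc (unique⇒lookup-injective uniq eq)

path-length≤order : ∀ {G u v} (P : Walk G u v) → IsPath P → #vertices P ≤ order G
path-length≤order {G} P path = injective⇒≤ (↔-id _) (V↔Fin G) (lookup (vertices P)) (unique⇒lookup-injective path)

-- No path condition is needed: erasing loops from a walk shortens it.
Rigid : ∀ {G u v} → Walk G u v → Set
Rigid {G} {u} {v} P = ∀ (Q : Walk G u v) → #vertices Q ≤ #vertices P → Identical Q P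

module _ {G : Graph} where

  open DecMembership (≟-via-↔ (V↔Fin G)) using (_∈?_)

  suffix : ∀ {u w v} (Q : Walk G w v) → IsPath Q → u ∈ vertices Q →
           ∃[ R ] (IsPath {G} {u} {v} R × #vertices R ≤ #vertices Q)
  suffix []      path (here refl)         = [] , path , ℕ.≤-refl
  suffix (e ∷ Q) path (here refl)         = e ∷ Q , path , ℕ.≤-refl
  suffix (e ∷ Q) (_ ∷ path) (there u∈Q) =
    let R , pathR , R≤Q = suffix Q path u∈Q in R , pathR , ℕ.m≤n⇒m≤1+n R≤Q

  -- The last component is the equality case: if no vertex is lost, nothing was erased, so the walk
  -- was a path already.
  erase-loops : ∀ {u v} (Q : Walk G u v) →
                ∃[ R ] (IsPath {G} {u} {v} R × #vertices R ≤ #vertices Q × (#vertices Q ≤ #vertices R → R ≡ Q))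
  erase-loops [] = [] , [] ∷ [] , ℕ.≤-refl , λ _ → refl
  erase-loops {u} (e ∷ Q) with R , path , R≤Q , eq ← erase-loops Q | u ∈? vertices R
  ... | yes u∈R = let R′ , path′ , R′≤R = suffix R path u∈R in
    R′ , path′ , ℕ.m≤n⇒m≤1+n (ℕ.≤-trans R′≤R R≤Q) ,
    λ Q<R′ → contradiction (ℕ.≤-trans Q<R′ (ℕ.≤-trans R′≤R R≤Q)) (ℕ.<-irrefl refl)
  ... | no u∉R = e ∷ R , ¬Any⇒All¬ _ u∉R ∷ path , s≤s R≤Q , λ Q≤R → cong (e ∷_) (eq (s≤s⁻¹ Q≤R))

  module _ {u v} {P : Walk G u v} where

    -- Let `R` be `Q` with its loops erased. Then `P` ≤ `R` ≤ `Q` ≤ `P` in number of vertices, so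
    -- `R` is `Q`; hence `Q` is a path and uniqueness applies to it.
    usp⇒rigid : IsUniqueShortestPath P → Rigid P
    usp⇒rigid usp Q Q≤P
      with R , path , R≤Q , eq ← erase-loops Q
      with refl ← eq (ℕ.≤-trans Q≤P (IsUniqueShortestPath.shortest usp R path))
      = IsUniqueShortestPath.unique usp Q path
          (ℕ.≤-antisym Q≤P (IsUniqueShortestPath.shortest usp Q path))

    rigid⇒shortest : Rigid P → ∀ Q → #vertices P ≤ #vertices Q
    rigid⇒shortest rigid Q with ℕ.≤-total (#vertices P) (#vertices Q)
    ... | inj₁ P≤Q = P≤Q
    ... | inj₂ Q≤P = ℕ.≤-reflexive (cong length (sym (proj₁ (rigid Q Q≤P))))

    rigid⇒usp : Rigid P → IsUniqueShortestPath P
    rigid⇒usp rigid = record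
      { isPath   = let R , path , R≤P , _ = erase-loops P in subst Unique (proj₁ (rigid R R≤P)) path
      ; shortest = λ Q _ → rigid⇒shortest rigid Q
      ; unique   = λ Q _ Q≡P → rigid Q (ℕ.≤-reflexive Q≡P)
      }

    rigid-length≤order : Rigid P → #vertices P ≤ order G
    rigid-length≤order rigid = path-length≤order P (IsUniqueShortestPath.isPath (rigid⇒usp rigid))

-- Candidates and spectator floors

-- A sum replaces the truncated difference. The path may be any rigid walk, so `s` is only an upper
-- bound for the spectator number of `H`.
Candidate : Graph → ℕ → Set₁
Candidate G s = ∃[ H ] ((G IsMinorOf H) × ∃[ u ] ∃[ v ] ∃[ P ] (Rigid {H} {u} {v} P × order H ≡ s + #vertices P))

-- `A` is not assumed decidable, whence the double negation. The number `d` is the room left above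
-- the current element `m`: an element of `A` that refutes the maximality of `m` restarts the search
-- with less room.
¬¬-greatest : ∀ {ℓ} (A : ℕ → Set ℓ) N → (∀ n → A n → n ≤ N) → ∀ {m} → A m → ¬ ¬ ∃ (IsGreatest A)
¬¬-greatest A N bounded {m} Am = go N m Am (λ n An → ℕ.≤-trans (bounded n An) (ℕ.m≤n+m N m))
  where
  go : ∀ d m → A m → (∀ n → A n → n ≤ m + d) → ¬ ¬ ∃ (IsGreatest A)
  go zero    m Am bound k = k (m , Am , λ n An → ℕ.≤-trans (bound n An) (ℕ.≤-reflexive (ℕ.+-identityʳ m)))
  go (suc d) m Am bound k = k (m , Am , λ n An → decidable-stable (n ≤? m) λ n≰m →
    go d n An (λ n′ An′ → ℕ.≤-trans (bound n′ An′)
      (ℕ.≤-trans (ℕ.≤-reflexive (ℕ.+-suc m d)) (ℕ.+-monoˡ-≤ d (ℕ.≰⇒> n≰m)))) k)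

-- A path of `H′` is at most as long as the parade number, so a candidate from `H′` is at least its
-- spectator number and hence at least `k`. The goal `k ≤ n` is decidable, which permits the use of
-- `¬¬-greatest`.
floor⇒least : ∀ {G k} → IsSpectatorFloor G k → IsLeast (Candidate G) k
floor⇒least {G} {k} ((H , G≼H , p , ((u , v , P , usp , refl) , _) , refl) , least) =
  (H , G≼H , u , v , P , usp⇒rigid usp , sym (ℕ.m∸n+n≡m (path-length≤order P (IsUniqueShortestPath.isPath usp)))) ,
  λ n (H′ , G≼H′ , _ , _ , P′ , rigid , size≡) → decidable-stable (k ≤? n) λ k≰n →
    ¬¬-greatest _ (order H′)
      (λ { _ (_ , _ , Q , uspQ , refl) → path-length≤order Q (IsUniqueShortestPath.isPath uspQ) })
      (_ , _ , P′ , rigid⇒usp rigid , refl)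
      λ (p , parade) → k≰n (ℕ.≤-trans (least _ (H′ , G≼H′ , p , parade , refl))
        (ℕ.≤-trans (ℕ.∸-monoʳ-≤ (order H′) (proj₂ parade _ (_ , _ , P′ , rigid⇒usp rigid , refl)))
          (ℕ.≤-reflexive (trans (cong (_∸ #vertices P′) size≡) (ℕ.m+n∸n≡m n (#vertices P′))))))

-- A unique shortest path of `H` longer than `P` would give a smaller candidate with the same `H`.
-- So `P` realises the parade number of `H`.
least⇒floor : ∀ {G k} → IsLeast (Candidate G) k → IsSpectatorFloor G k
least⇒floor {G} {k} ((H , G≼H , u , v , P , rigid , size≡) , least) =
  (H , G≼H , #vertices P , ((u , v , P , rigid⇒usp rigid , refl) , greatest) ,
    sym (trans (cong (_∸ #vertices P) size≡) (ℕ.m+n∸n≡m k (#vertices P)))) ,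
  λ { _ (H′ , G≼H′ , _ , ((_ , _ , Q , usp , refl) , _) , refl) → least _
    (H′ , G≼H′ , _ , _ , Q , usp⇒rigid usp , sym (ℕ.m∸n+n≡m (path-length≤order Q (IsUniqueShortestPath.isPath usp)))) }
  where
  greatest : ∀ n → ∃[ u ] ∃[ v ] ∃[ Q ] (IsUniqueShortestPath {H} {u} {v} Q × #vertices Q ≡ n) → n ≤ #vertices P
  greatest _ (_ , _ , Q , usp , refl) = ℕ.+-cancelˡ-≤ k _ _
    (ℕ.≤-trans (ℕ.+-monoˡ-≤ (#vertices Q) (least _ (H , G≼H , _ , _ , Q , usp⇒rigid usp , sym Q+)))
      (ℕ.≤-reflexive (trans Q+ size≡)))
    where
    Q+ : order H ∸ #vertices Q + #vertices Q ≡ order H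
    Q+ = ℕ.m∸n+n≡m (path-length≤order Q (IsUniqueShortestPath.isPath usp))

-- Rigid walks in subgraphs

module _ {G H : Graph} (i : Embedding G H) where

  open Embedding i

  mapWalk : ∀ {u v} → Walk G u v → Walk H (onV u) (onV v)
  mapWalk []            = []
  mapWalk ((e , j) ∷ P) = (onE e , preserves e _ _ j) ∷ mapWalk P

  vertices-mapWalk : ∀ {u v} (P : Walk G u v) → vertices (mapWalk P) ≡ map onV (vertices P)
  vertices-mapWalk []      = refl
  vertices-mapWalk (_ ∷ P) = cong (_ ∷_) (vertices-mapWalk P)

  edges-mapWalk : ∀ {u v} (P : Walk G u v) → edges (mapWalk P) ≡ map onE (edges P)
  edges-mapWalk []      = refl
  edges-mapWalk (_ ∷ P) = cong (_ ∷_) (edges-mapWalk P)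

  #vertices-mapWalk : ∀ {u v} (P : Walk G u v) → #vertices (mapWalk P) ≡ #vertices P
  #vertices-mapWalk P = trans (cong length (vertices-mapWalk P)) (length-map onV (vertices P))

  -- A competitor in `G` is, under the embedding, a competitor in `H` with as many vertices;
  -- injectivity brings the identity back. The image of `Q` is compared with `P` by `Identical`,
  -- which looks at vertices and edges and ignores the incidence proofs.
  rigid-reflects : ∀ {u v} {P : Walk H (onV u) (onV v)} (Q : Walk G u v) →
                   Identical (mapWalk Q) P → Rigid P → Rigid Q
  rigid-reflects {P = P} Q (v≡ , e≡) rigid R R≤Q =
    map-injective onV-injective
      (trans (sym (vertices-mapWalk R)) (trans (proj₁ same) (trans (sym v≡) (vertices-mapWalk Q)))) ,
    map-injective onE-injective
      (trans (sym (edges-mapWalk R)) (trans (proj₂ same) (trans (sym e≡) (edges-mapWalk Q))))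
    where
    same : Identical (mapWalk R) P
    same = rigid (mapWalk R) (ℕ.≤-trans (ℕ.≤-reflexive (#vertices-mapWalk R))
      (ℕ.≤-trans R≤Q (ℕ.≤-reflexive (trans (sym (#vertices-mapWalk Q)) (cong length v≡)))))

module _ {G : Graph} where

  first∈ : ∀ {u v} (P : Walk G u v) → u ∈ vertices P
  first∈ []      = here refl
  first∈ (_ ∷ _) = here refl

  last∈ : ∀ {u v} (P : Walk G u v) → v ∈ vertices P
  last∈ []      = here refl
  last∈ (_ ∷ P) = there (last∈ P)

module _ (H : Graph) {S : V H → Set} (S? : Decidable S) (x₀ : Refinement (V H) S) where

  restrict : ∀ {u v} (P : Walk H u v) (inS : ∀ {x} → x ∈ vertices P → S x) →
             Walk (induced H S? x₀) (u , [ inS (first∈ P) ]) (v , [ inS (last∈ P) ])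
  restrict []            inS = []
  restrict ((e , j) ∷ P) inS =
    ((e , [ both ]) , subgraph-joins⁺ H S? (bothEnds? H S?) id x₀ (e , [ both ]) _ _ j) ∷ restrict P (inS ∘ there)
    where
    both : BothEnds H S e
    both = bothEnds⁺ H S j (inS (here refl)) (inS (there (first∈ P)))

  restrict-identical : ∀ {u v} (P : Walk H u v) (inS : ∀ {x} → x ∈ vertices P → S x) →
    Identical (mapWalk (subgraph-embedding H S? (bothEnds? H S?) id x₀) (restrict P inS)) P
  restrict-identical []      inS = refl , refl
  restrict-identical (_ ∷ P) inS =
    let v≡ , e≡ = restrict-identical P (inS ∘ there) in cong (_ ∷_) v≡ , cong (_ ∷_) e≡

-- Disjoint unions

embedding-⊔ˡ : ∀ G K → Embedding G (G ⊔ K)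
embedding-⊔ˡ G K = record
  { onV = inj₁ ; onE = inj₁
  ; onV-injective = λ { refl → refl } ; onE-injective = λ { refl → refl }
  ; preserves = λ { e u v (inj₁ refl) → inj₁ refl ; e u v (inj₂ refl) → inj₂ refl }
  }

embedding-⊔ʳ : ∀ G K → Embedding K (G ⊔ K)
embedding-⊔ʳ G K = record
  { onV = inj₂ ; onE = inj₂
  ; onV-injective = λ { refl → refl } ; onE-injective = λ { refl → refl }
  ; preserves = λ { e u v (inj₁ refl) → inj₁ refl ; e u v (inj₂ refl) → inj₂ refl }
  }

⊔-comm : ∀ G K → Embedding (G ⊔ K) (K ⊔ G)
⊔-comm G K = record
  { onV = swap ; onE = swap
  ; onV-injective = swap-injective ; onE-injective = swap-injective
  ; preserves = λ
    { (inj₁ e) u v (inj₁ refl) → inj₁ refl ; (inj₁ e) u v (inj₂ refl) → inj₂ refl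
    ; (inj₂ e) u v (inj₁ refl) → inj₁ refl ; (inj₂ e) u v (inj₂ refl) → inj₂ refl }
  }
  where
  swap-injective : ∀ {A B : Set} → Injective _≡_ _≡_ (swap {A = A} {B = B})
  swap-injective {x = inj₁ _} {inj₁ _} refl = refl
  swap-injective {x = inj₂ _} {inj₂ _} refl = refl

map₁-injective : ∀ {A B C : Set} {f : A → C} → Injective _≡_ _≡_ f →
                  Injective _≡_ _≡_ (Sum.map₁ {B = B} f)
map₁-injective inj {inj₁ _} {inj₁ _} eq = cong inj₁ (inj (inj₁-injective eq))
map₁-injective inj {inj₂ _} {inj₂ _} refl = refl

⊔-joins-map : ∀ {G H : Graph} (K : Graph) (fV : V G → V H) (fE : E G → E H) →
  (∀ e u v → Joins G e u v → Joins H (fE e) (fV u) (fV v)) →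
  ∀ e u v → Joins (G ⊔ K) e u v → Joins (H ⊔ K) (Sum.map₁ fE e) (Sum.map₁ fV u) (Sum.map₁ fV v)
⊔-joins-map {G} {H} K fV fE preserves (inj₁ e) u v (inj₁ refl) =
  Embedding.preserves (embedding-⊔ˡ H K) _ _ _ (preserves e _ _ (inj₁ refl))
⊔-joins-map {G} {H} K fV fE preserves (inj₁ e) u v (inj₂ refl) =
  Embedding.preserves (embedding-⊔ˡ H K) _ _ _ (preserves e _ _ (inj₂ refl))
⊔-joins-map K fV fE preserves (inj₂ e) u v (inj₁ refl) = inj₁ refl
⊔-joins-map K fV fE preserves (inj₂ e) u v (inj₂ refl) = inj₂ refl

⊔-embedding : ∀ {G H} K → Embedding G H → Embedding (G ⊔ K) (H ⊔ K)
⊔-embedding {G} {H} K i = record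
  { onV = Sum.map₁ onV ; onE = Sum.map₁ onE
  ; onV-injective = map₁-injective onV-injective ; onE-injective = map₁-injective onE-injective
  ; preserves = ⊔-joins-map {G} {H} K onV onE preserves
  } where open Embedding i

-- An edge parallel to the contracted one has its ends in `H`, so it is an edge of `H` and the
-- hypothesis on `H` covers it.
⊔-contraction : ∀ {H H′} K → Contraction H H′ → Contraction (H ⊔ K) (H′ ⊔ K)
⊔-contraction {H} {H′} K k = record
  { contracted = inj₁ contracted
  ; u = inj₁ u
  ; v = inj₁ v
  ; joins = Embedding.preserves (embedding-⊔ˡ H K) _ _ _ joins
  ; noParallel = noPar
  ; quotient = Sum.map₁ quotient
  ; surjective = λ
    { (inj₁ y) → let x , qx≡y = surjective y in inj₁ x , λ { refl → cong inj₁ (qx≡y refl) }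
    ; (inj₂ y) → inj₂ y , λ { refl → refl } }
  ; identifies = cong inj₁ identifies
  ; separates = sep
  ; onE = record
    { to = Sum.map₁ to
    ; injective = map₁-injective injective
    ; avoids = λ { (inj₁ e) eq → avoids e (inj₁-injective eq) }
    ; covers = λ
      { (inj₁ e) e≢ → let f , eq = covers e (e≢ ∘ cong inj₁) in inj₁ f , cong inj₁ eq
      ; (inj₂ e) _ → inj₂ e , refl }
    }
  ; preserves = pres
  }
  where
  open Contraction k
  open _≃_∖_ onE
  noPar : ∀ f → Joins (H ⊔ K) f (inj₁ u) (inj₁ v) → f ≡ inj₁ contracted
  noPar (inj₁ f) (inj₁ refl) = cong inj₁ (noParallel f (inj₁ refl))
  noPar (inj₁ f) (inj₂ refl) = cong inj₁ (noParallel f (inj₂ refl))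
  noPar (inj₂ f) (inj₁ ())
  noPar (inj₂ f) (inj₂ ())
  sep : ∀ x y → Sum.map₁ quotient x ≡ Sum.map₁ quotient y →
        x ≡ y ⊎ (x ≡ inj₁ u × y ≡ inj₁ v) ⊎ (x ≡ inj₁ v × y ≡ inj₁ u)
  sep (inj₁ x) (inj₁ y) eq =
    Sum.map (cong inj₁) (Sum.map both both) (separates x y (inj₁-injective eq))
    where
    both : ∀ {a b} → x ≡ a × y ≡ b → _≡_ {A = V H ⊎ V K} (inj₁ x) (inj₁ a) × inj₁ y ≡ inj₁ b
    both = Product.map (cong inj₁) (cong inj₁)
  sep (inj₂ x) (inj₂ y) refl = inj₁ refl
  pres : ∀ f x y → Joins (H ⊔ K) (Sum.map₁ to f) x y → Joins (H′ ⊔ K) f (Sum.map₁ quotient x) (Sum.map₁ quotient y)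
  pres (inj₁ f) x y (inj₁ refl) = Embedding.preserves (embedding-⊔ˡ H′ K) _ _ _ (preserves f _ _ (inj₁ refl))
  pres (inj₁ f) x y (inj₂ refl) = Embedding.preserves (embedding-⊔ˡ H′ K) _ _ _ (preserves f _ _ (inj₂ refl))
  pres (inj₂ f) x y (inj₁ refl) = inj₁ refl
  pres (inj₂ f) x y (inj₂ refl) = inj₂ refl

⊔-⟶ : ∀ {H H′} K → H ⟶ H′ → (H′ ⊔ K) IsMinorOf (H ⊔ K)
⊔-⟶ K (deleteVertex d) = embedding⇒minor (⊔-embedding K (vertexDeletion⇒embedding d))
⊔-⟶ K (deleteEdge d)   = embedding⇒minor (⊔-embedding K (edgeDeletion⇒embedding d))
⊔-⟶ K (contractEdge k) = contractEdge (⊔-contraction K k) ◅ₘ minor-refl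

⊔-minorˡ : ∀ {G H} K → G IsMinorOf H → (G ⊔ K) IsMinorOf (H ⊔ K)
⊔-minorˡ K (_ , ε , H≅G)              = embedding⇒minor (⊔-embedding K (≅⇒embedding (≅-sym H≅G)))
⊔-minorˡ K (_ , step ◅ steps , H′≅G) =
  minor-trans (⊔-minorˡ K (_ , steps , H′≅G)) (⊔-⟶ K step)

-- One summand is replaced at a time; `⊔-comm` brings each to the left, where `⊔-minorˡ` acts.
⊔-minor : ∀ {G H G′ H′} → G IsMinorOf H → G′ IsMinorOf H′ → (G ⊔ G′) IsMinorOf (H ⊔ H′)
⊔-minor {G} {H} {G′} {H′} G≼H G′≼H′ =
  minor-trans (embedding⇒minor (⊔-comm G G′))
    (minor-trans (⊔-minorˡ G G′≼H′)
      (minor-trans (embedding⇒minor (⊔-comm H′ G)) (⊔-minorˡ H′ G≼H)))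

-- Joining two graphs by a bridge

addEdge : (G : Graph) (x y : V G) → x ≢ y → Graph
addEdge G x y x≢y = record
  { V = V G
  ; E = E G ⊎ Fin 1
  ; order = order G
  ; size = size G + 1
  ; V↔Fin = V↔Fin G
  ; E↔Fin = ↔-sym Fin.+↔⊎ ↔-∘ (E↔Fin G ⊎-↔ ↔-id _)
  ; nonempty = nonempty G
  ; ends = Sum.[ ends G , (λ _ → x , y) ]
  ; loopless = λ { (inj₁ e) → loopless G e ; (inj₂ _) → x≢y }
  }

embedding-addEdge : ∀ G x y x≢y → Embedding G (addEdge G x y x≢y)
embedding-addEdge G x y x≢y = record
  { onV = id ; onE = inj₁
  ; onV-injective = id ; onE-injective = λ { refl → refl }
  ; preserves = λ _ _ _ → id
  }

inj₁≢inj₂ : ∀ {A B : Set} {a : A} {b : B} → inj₁ a ≢ inj₂ b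
inj₁≢inj₂ ()

module _ (H₁ H₂ : Graph) (t : V H₁) (s : V H₂) where

  bridged : Graph
  bridged = addEdge (H₁ ⊔ H₂) (inj₁ t) (inj₂ s) inj₁≢inj₂

  private
    ι₁ : Embedding H₁ bridged
    ι₁ = embedding-addEdge (H₁ ⊔ H₂) (inj₁ t) (inj₂ s) inj₁≢inj₂ ∘ₑ embedding-⊔ˡ H₁ H₂
    ι₂ : Embedding H₂ bridged
    ι₂ = embedding-addEdge (H₁ ⊔ H₂) (inj₁ t) (inj₂ s) inj₁≢inj₂ ∘ₑ embedding-⊔ʳ H₁ H₂

  infixr 5 _▷_
  _▷_ : ∀ {u v} → Walk H₁ u t → Walk H₂ s v → Walk bridged (inj₁ u) (inj₂ v)
  []            ▷ R = (inj₂ zero , inj₁ refl) ∷ mapWalk ι₂ R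
  ((e , j) ∷ A) ▷ R = (inj₁ (inj₁ e) , Embedding.preserves ι₁ e _ _ j) ∷ (A ▷ R)

  vertices-▷ : ∀ {u v} (A : Walk H₁ u t) (R : Walk H₂ s v) →
               vertices (A ▷ R) ≡ map inj₁ (vertices A) ++ map inj₂ (vertices R)
  vertices-▷ []      R = cong (_ ∷_) (vertices-mapWalk ι₂ R)
  vertices-▷ (_ ∷ A) R = cong (_ ∷_) (vertices-▷ A R)

  edges-▷ : ∀ {u v} (A : Walk H₁ u t) (R : Walk H₂ s v) →
            edges (A ▷ R) ≡ map (inj₁ ∘ inj₁) (edges A) ++ inj₂ zero ∷ map (inj₁ ∘ inj₂) (edges R)
  edges-▷ []      R = cong (_ ∷_) (edges-mapWalk ι₂ R)
  edges-▷ (_ ∷ A) R = cong (_ ∷_) (edges-▷ A R)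

  #vertices-▷ : ∀ {u v} (A : Walk H₁ u t) (R : Walk H₂ s v) → #vertices (A ▷ R) ≡ #vertices A + #vertices R
  #vertices-▷ []      R = cong suc (#vertices-mapWalk ι₂ R)
  #vertices-▷ (_ ∷ A) R = cong suc (#vertices-▷ A R)

  -- The walk is cut at its first crossing of the bridge; a later return to H₁
  -- costs extra vertices, which is what the last component records.
  cut : ∀ {u v} (Q : Walk bridged (inj₁ u) (inj₂ v)) →
        ∃[ A ] ∃[ R ] (#vertices {H₁} {u} {t} A + #vertices {H₂} {s} {v} R ≤ #vertices Q
          × (#vertices Q ≤ #vertices A + #vertices R → Identical Q (A ▷ R)))
  project₂ : ∀ {x v} (Q : Walk bridged (inj₂ x) (inj₂ v)) →
             ∃[ R ] (#vertices {H₂} {x} {v} R ≤ #vertices Q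
               × (#vertices Q ≤ #vertices R → Identical Q (mapWalk ι₂ R)))
  private
    prepend₁ : ∀ {u w v} {Q : Walk bridged (inj₁ w) (inj₂ v)} e (j : Joins H₁ e u w) j′ →
      ∃[ A ] ∃[ R ] (#vertices {H₁} {w} {t} A + #vertices {H₂} {s} {v} R ≤ #vertices Q
          × (#vertices Q ≤ #vertices A + #vertices R → Identical Q (A ▷ R))) →
      ∃[ A ] ∃[ R ] (#vertices {H₁} {u} {t} A + #vertices {H₂} {s} {v} R ≤ suc (#vertices Q)
          × (suc (#vertices Q) ≤ #vertices A + #vertices R → Identical {bridged} ((inj₁ (inj₁ e) , j′) ∷ Q) (A ▷ R)))
    prepend₁ e j _ (A , R , ≤Q , same) = (e , j) ∷ A , R , s≤s ≤Q ,
      λ le → let v≡ , e≡ = same (s≤s⁻¹ le) in cong (_ ∷_) v≡ , cong (_ ∷_) e≡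
    prepend₂ : ∀ {u w v} {Q : Walk bridged (inj₂ w) (inj₂ v)} e (j : Joins H₂ e u w) j′ →
      ∃[ R ] (#vertices {H₂} {w} {v} R ≤ #vertices Q
               × (#vertices Q ≤ #vertices R → Identical Q (mapWalk ι₂ R))) →
      ∃[ R ] (#vertices {H₂} {u} {v} R ≤ suc (#vertices Q)
               × (suc (#vertices Q) ≤ #vertices R → Identical {bridged} ((inj₁ (inj₂ e) , j′) ∷ Q) (mapWalk ι₂ R)))
    prepend₂ e j _ (R , ≤Q , same) = (e , j) ∷ R , s≤s ≤Q ,
      λ le → let v≡ , e≡ = same (s≤s⁻¹ le) in cong (_ ∷_) v≡ , cong (_ ∷_) e≡
  cut ((inj₁ (inj₁ e) , inj₁ refl) ∷ Q) = prepend₁ e (inj₁ refl) (inj₁ refl) (cut Q)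
  cut ((inj₁ (inj₁ e) , inj₂ refl) ∷ Q) = prepend₁ e (inj₂ refl) (inj₂ refl) (cut Q)
  cut ((inj₁ (inj₂ e) , inj₁ ()) ∷ Q)
  cut ((inj₁ (inj₂ e) , inj₂ ()) ∷ Q)
  cut ((inj₂ zero , inj₁ refl) ∷ Q) = let R , R≤Q , same = project₂ Q in
    [] , R , s≤s R≤Q , λ le → let v≡ , e≡ = same (s≤s⁻¹ le) in cong (_ ∷_) v≡ , cong (_ ∷_) e≡
  project₂ [] = [] , ℕ.≤-refl , λ _ → refl , refl
  project₂ ((inj₁ (inj₁ e) , inj₁ ()) ∷ Q)
  project₂ ((inj₁ (inj₁ e) , inj₂ ()) ∷ Q)
  project₂ ((inj₁ (inj₂ e) , inj₁ refl) ∷ Q) = prepend₂ e (inj₁ refl) (inj₁ refl) (project₂ Q)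
  project₂ ((inj₁ (inj₂ e) , inj₂ refl) ∷ Q) = prepend₂ e (inj₂ refl) (inj₂ refl) (project₂ Q)
  -- The walk returns to `H₁` from `s`, so the `H₂` part of `cut Q` also runs from the current
  -- vertex to the end. It fits within `Q`; the step back makes the whole walk strictly longer, and
  -- the equality case is void.
  project₂ ((inj₂ zero , inj₂ refl) ∷ Q) = let A , R , ≤Q , _ = cut Q
                                               R≤Q = ℕ.≤-trans (ℕ.m≤n+m _ (#vertices A)) ≤Q in
    R , ℕ.m≤n⇒m≤1+n R≤Q , λ Q<R → contradiction (ℕ.≤-trans Q<R R≤Q) (ℕ.<-irrefl refl)

  -- Cutting a competitor at the bridge gives `A′` and `R′`, each at least as long as `A` and `R`,
  -- while the sum of their lengths is at most that of `A` and `R`. So equality holds in each half,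
  -- and rigidity applies to each.
  ▷-rigid : ∀ {u v} {A : Walk H₁ u t} {R : Walk H₂ s v} → Rigid A → Rigid R → Rigid (A ▷ R)
  ▷-rigid {A = A} {R} rigidA rigidR Q Q≤
    with A′ , R′ , A′+R′≤Q , same ← cut Q
    = trans v≡ (trans (vertices-▷ A′ R′)
        (trans (cong₂ (λ vs ws → map inj₁ vs ++ map inj₂ ws) (proj₁ A≈) (proj₁ R≈)) (sym (vertices-▷ A R)))) ,
      trans e≡ (trans (edges-▷ A′ R′)
        (trans (cong₂ (λ es fs → map (inj₁ ∘ inj₁) es ++ inj₂ zero ∷ map (inj₁ ∘ inj₂) fs) (proj₂ A≈) (proj₂ R≈))
          (sym (edges-▷ A R))))
    where
    Q≤A+R : #vertices Q ≤ #vertices A + #vertices R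
    Q≤A+R = ℕ.≤-trans Q≤ (ℕ.≤-reflexive (#vertices-▷ A R))
    A≤A′ : #vertices A ≤ #vertices A′
    A≤A′ = rigid⇒shortest rigidA A′
    R≤R′ : #vertices R ≤ #vertices R′
    R≤R′ = rigid⇒shortest rigidR R′
    A≈ : Identical A′ A
    A≈ = rigidA A′ (ℕ.+-cancelʳ-≤ (#vertices R) _ _
           (ℕ.≤-trans (ℕ.+-monoʳ-≤ (#vertices A′) R≤R′) (ℕ.≤-trans A′+R′≤Q Q≤A+R)))
    R≈ : Identical R′ R
    R≈ = rigidR R′ (ℕ.+-cancelˡ-≤ (#vertices A) _ _
           (ℕ.≤-trans (ℕ.+-monoˡ-≤ (#vertices R′) A≤A′) (ℕ.≤-trans A′+R′≤Q Q≤A+R)))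
    Q≈ : Identical Q (A′ ▷ R′)
    Q≈ = same (ℕ.≤-trans Q≤A+R (ℕ.+-mono-≤ A≤A′ R≤R′))
    v≡ = proj₁ Q≈
    e≡ = proj₂ Q≈

embedding-minor : ∀ {F G H} → Embedding F G → G IsMinorOf H → F IsMinorOf H
embedding-minor i = minor-trans (embedding⇒minor i)

-- The bridge adds no vertex, and both the orders and the lengths of the paths add up; hence so do
-- the numbers of vertices off the paths.
candidate-⊔ : ∀ G G₁ G₂ {s₁ s₂} → G ≅ (G₁ ⊔ G₂) → Candidate G₁ s₁ → Candidate G₂ s₂ → Candidate G (s₁ + s₂)
candidate-⊔ G G₁ G₂ {s₁} {s₂} G≅
  (H₁ , G₁≼H₁ , _ , t , P₁ , rigid₁ , order₁) (H₂ , G₂≼H₂ , s , _ , P₂ , rigid₂ , order₂) =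
  bridged H₁ H₂ t s ,
  embedding-minor (≅⇒embedding G≅) (minor-trans (⊔-minor G₁≼H₁ G₂≼H₂)
    (embedding⇒minor (embedding-addEdge (H₁ ⊔ H₂) (inj₁ t) (inj₂ s) inj₁≢inj₂))) ,
  _ , _ , _▷_ H₁ H₂ t s P₁ P₂ , ▷-rigid H₁ H₂ t s rigid₁ rigid₂ ,
  trans (cong₂ _+_ order₁ order₂)
    (trans (interchange s₁ _ s₂ _) (cong (s₁ + s₂ +_) (sym (#vertices-▷ H₁ H₂ t s P₁ P₂))))

-- Adding a path to each colour class

module _ {H : Graph} (c : V H → Bool) {u v} (P : Walk H u v) (rigid : Rigid P) where

  open DecMembership (≟-via-↔ (V↔Fin H)) using (_∈?_)

  ColouredOrOn : Bool → V H → Set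
  ColouredOrOn b x = c x ≡ b ⊎ x ∈ vertices P

  colouredOrOn? : ∀ b → Decidable (ColouredOrOn b)
  colouredOrOn? b x = (c x Bool.≟ b) ⊎-dec (x ∈? vertices P)

  withPath : Bool → Graph
  withPath b = induced H (colouredOrOn? b) (u , [ inj₂ (first∈ P) ])

  withPath-rigid : ∀ b → ∃[ x ] ∃[ y ] ∃[ Q ] (Rigid {withPath b} {x} {y} Q × #vertices Q ≡ #vertices P)
  withPath-rigid b = _ , _ , Q , rigid-reflects ι Q Q≈P rigid ,
    trans (sym (#vertices-mapWalk ι Q)) (cong length (proj₁ Q≈P))
    where
    ι = subgraph-embedding H (colouredOrOn? b) (bothEnds? H (colouredOrOn? b)) id (u , [ inj₂ (first∈ P) ])
    Q = restrict H (colouredOrOn? b) (u , [ inj₂ (first∈ P) ]) P inj₂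
    Q≈P = restrict-identical H (colouredOrOn? b) (u , [ inj₂ (first∈ P) ]) P inj₂

  path≤withPath : ∀ b → #vertices P ≤ order (withPath b)
  path≤withPath b = let _ , _ , Q , rigidQ , #Q = withPath-rigid b in
    subst (_≤ order (withPath b)) #Q (rigid-length≤order rigidQ)

  withPath-candidate : ∀ b {G x} → G IsMinorOf colourClass H c b x → Candidate G (order (withPath b) ∸ #vertices P)
  withPath-candidate b {x = x} G≼ = let _ , _ , Q , rigidQ , #Q = withPath-rigid b in
    withPath b , minor-trans G≼ (embedding⇒minor class↪) , _ , _ , Q , rigidQ ,
    trans (sym (ℕ.m∸n+n≡m (path≤withPath b))) (cong (order (withPath b) ∸ #vertices P +_) (sym #Q))
    where
    class↪ : Embedding (colourClass H c b x) (withPath b)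
    class↪ = induced-embedding {H} {H} (≅⇒embedding ≅-refl) (colour? H c b) (colouredOrOn? b) (λ _ → inj₁) x _

  -- Prepares an injection of the two vertex sets, taken disjointly, into the vertices of `H` plus
  -- the positions on `P`. A vertex of the colour of its graph is sent to itself; one that is there
  -- only because it lies on `P` is sent to a position on `P`.
  Placed : Bool → V H → V H ⊎ Fin (#vertices P) → Set
  Placed b x (inj₁ y) = c x ≡ b × x ≡ y
  Placed b x (inj₂ i) = c x ≢ b × x ≡ lookup (vertices P) i

  place : ∀ b (r : V (withPath b)) → ∃ (Placed b (value r))
  place b (x , [ s ]) with c x Bool.≟ b
  ... | yes cx≡b = inj₁ x , cx≡b , refl
  ... | no  cx≢b = inj₂ (index x∈P) , cx≢b , lookup-index x∈P
    where
    x∈P : x ∈ vertices P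
    x∈P = Sum.fromInj₂ (λ cx≡b → contradiction cx≡b cx≢b) (recompute (colouredOrOn? b x) s)

  -- A vertex is sent to itself only from the graph of its own colour, and to a position on `P` only
  -- from the graph of the other colour. As there are two colours, the image determines the graph in
  -- both cases.
  placed-unique : ∀ {b b′ x x′} y → Placed b x y → Placed b′ x′ y → b ≡ b′ × x ≡ x′
  placed-unique (inj₁ y) (refl , refl) (refl , refl) = refl , refl
  placed-unique (inj₂ i) (cx≢b , refl) (cx≢b′ , refl) =
    trans (¬-not (cx≢b ∘ sym)) (sym (¬-not (cx≢b′ ∘ sym))) , refl

  -- Off P the two vertex sets are disjoint, and P is counted twice.
  order-withPath : order (withPath true) + order (withPath false) ≤ order H + #vertices P
  order-withPath = injective⇒≤
    (↔-sym Fin.+↔⊎ ↔-∘ (V↔Fin (withPath true) ⊎-↔ V↔Fin (withPath false)))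
    (↔-sym Fin.+↔⊎ ↔-∘ (V↔Fin H ⊎-↔ ↔-id _)) f f-injective
    where
    f : V (withPath true) ⊎ V (withPath false) → V H ⊎ Fin (#vertices P)
    f (inj₁ r) = proj₁ (place true r)
    f (inj₂ r) = proj₁ (place false r)
    same : ∀ b b′ r r′ → proj₁ (place b r) ≡ proj₁ (place b′ r′) → b ≡ b′ × value r ≡ value r′
    same b b′ r r′ eq = placed-unique _ (proj₂ (place b r)) (subst (Placed b′ (value r′)) (sym eq) (proj₂ (place b′ r′)))
    f-injective : Injective _≡_ _≡_ f
    f-injective {inj₁ r} {inj₁ r′} eq = cong inj₁ (value-injective (proj₂ (same true true r r′ eq)))
    f-injective {inj₂ r} {inj₂ r′} eq = cong inj₂ (value-injective (proj₂ (same false false r r′ eq)))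
    f-injective {inj₁ r} {inj₂ r′} eq with () ← proj₁ (same true false r r′ eq)
    f-injective {inj₂ r} {inj₁ r′} eq with () ← proj₁ (same false true r r′ eq)

  excess-withPath : ∀ {s} → order H ≡ s + #vertices P →
    (order (withPath true) ∸ #vertices P) + (order (withPath false) ∸ #vertices P) ≤ s
  -- `P` fits in both graphs, so adding `p` once for each turns the truncated differences into exact
  -- ones.
  excess-withPath {s} size≡ = ℕ.+-cancelʳ-≤ (p + p) _ _ (begin
    (o₁ ∸ p + (o₂ ∸ p)) + (p + p)   ≡⟨ interchange (o₁ ∸ p) _ _ _ ⟩
    (o₁ ∸ p + p) + (o₂ ∸ p + p)     ≡⟨ cong₂ _+_ (ℕ.m∸n+n≡m (path≤withPath true)) (ℕ.m∸n+n≡m (path≤withPath false)) ⟩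
    o₁ + o₂                         ≤⟨ order-withPath ⟩
    order H + p                     ≡⟨ cong (_+ p) size≡ ⟩
    s + p + p                       ≡⟨ ℕ.+-assoc s p p ⟩
    s + (p + p)                     ∎)
    where
    open ℕ.≤-Reasoning
    p  = #vertices P
    o₁ = order (withPath true)
    o₂ = order (withPath false)

-- Splitting and combining least candidates

side : ∀ {A B : Set} → A ⊎ B → Bool
side = Sum.[ (λ _ → true) , (λ _ → false) ]

-- The last graph `H′` of the reduction is coloured by the summand in which a vertex lands, and each
-- summand embeds in its class. The classes are then lifted along the steps to `H`, with base points
-- coming from the vertices of `G₁` and `G₂`.
⊔-separates : ∀ G G₁ G₂ {H} → G ≅ (G₁ ⊔ G₂) → G IsMinorOf H →
  ∃[ c ] ∃[ x ] ∃[ y ] ((G₁ IsMinorOf colourClass H c true x) × (G₂ IsMinorOf colourClass H c false y))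
⊔-separates G G₁ G₂ G≅ (H′ , steps , H′≅G) =
  let x₁ , minor₁ = lift true (Embedding.onV i₁ (nonempty G₁) , [ in₁ _ ])
      x₂ , minor₂ = lift false (Embedding.onV i₂ (nonempty G₂) , [ in₂ _ ])
  in colour , x₁ , x₂ , embedding-minor (corestrict-induced H′ (colour? H′ c′ true) _ i₁ in₁) minor₁
                      , embedding-minor (corestrict-induced H′ (colour? H′ c′ false) _ i₂ in₂) minor₂
  where
  iso : H′ ≅ (G₁ ⊔ G₂)
  iso = ≅-trans H′≅G G≅
  c′ : V H′ → Bool
  c′ = side ∘ Inverse.to (_≅_.onV iso)
  open ColourLift (star-colourLift steps c′)
  i₁ : Embedding G₁ H′
  i₁ = ≅⇒embedding (≅-sym iso) ∘ₑ embedding-⊔ˡ G₁ G₂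
  i₂ : Embedding G₂ H′
  i₂ = ≅⇒embedding (≅-sym iso) ∘ₑ embedding-⊔ʳ G₁ G₂
  in₁ : ∀ x → c′ (Embedding.onV i₁ x) ≡ true
  in₁ x = cong side (Inverse.strictlyInverseˡ (_≅_.onV iso) (inj₁ x))
  in₂ : ∀ x → c′ (Embedding.onV i₂ x) ≡ false
  in₂ x = cong side (Inverse.strictlyInverseˡ (_≅_.onV iso) (inj₂ x))

colouring-candidates : ∀ {G₁ G₂ H u v s} (c : V H → Bool) (P : Walk H u v) → Rigid P → order H ≡ s + #vertices P → ∀ {x y} → 
  G₁ IsMinorOf colourClass H c true x → G₂ IsMinorOf colourClass H c false y →
  ∃[ s₁ ] ∃[ s₂ ] (Candidate G₁ s₁ × Candidate G₂ s₂ × s₁ + s₂ ≤ s)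
colouring-candidates {H = H} {s = s} c P rigid size≡ {x} {y} G₁≼ G₂≼ =
  order (withPath {H} c P rigid true) ∸ #vertices P , order (withPath {H} c P rigid false) ∸ #vertices P ,
  withPath-candidate {H} c P rigid true {x = x} G₁≼ ,
  withPath-candidate {H} c P rigid false {x = y} G₂≼ ,
  excess-withPath {H} c P rigid {s} size≡

candidate-split : ∀ G G₁ G₂ {s} → G ≅ (G₁ ⊔ G₂) → Candidate G s →
  ∃[ s₁ ] ∃[ s₂ ] (Candidate G₁ s₁ × Candidate G₂ s₂ × s₁ + s₂ ≤ s)
candidate-split G G₁ G₂ G≅ (H , G≼H , _ , _ , P , rigid , size≡) =
  let c , x , y , G₁≼ , G₂≼ = ⊔-separates G G₁ G₂ {H} G≅ G≼H in
  colouring-candidates {G₁} {G₂} {H} c P rigid size≡ {x} {y} G₁≼ G₂≼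

module _ (G G₁ G₂ : Graph) (G≅ : G ≅ (G₁ ⊔ G₂)) where

  -- The pieces of a least candidate are themselves least: if `n` is a candidate for `G₁`, then
  -- `n + k₂` is one for `G`, so `k₁ + k₂ ≤ k ≤ n + k₂` and `k₂` cancels. The argument for `G₂` is
  -- symmetric.
  least-candidate-split : ∀ {k} → IsLeast (Candidate G) k →
    ∃[ k₁ ] ∃[ k₂ ] (IsLeast (Candidate G₁) k₁ × IsLeast (Candidate G₂) k₂ × k ≡ k₁ + k₂)
  least-candidate-split {k} (cand , least) = minimal (candidate-split G G₁ G₂ G≅ cand)
    where
    minimal : ∃[ k₁ ] ∃[ k₂ ] (Candidate G₁ k₁ × Candidate G₂ k₂ × k₁ + k₂ ≤ k) →
              ∃[ k₁ ] ∃[ k₂ ] (IsLeast (Candidate G₁) k₁ × IsLeast (Candidate G₂) k₂ × k ≡ k₁ + k₂)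
    minimal (k₁ , k₂ , cand₁ , cand₂ , k₁+k₂≤k) =
      k₁ , k₂ ,
      (cand₁ , λ n c → ℕ.+-cancelʳ-≤ k₂ _ _ (ℕ.≤-trans k₁+k₂≤k (least _ (candidate-⊔ G G₁ G₂ G≅ c cand₂)))) ,
      (cand₂ , λ n c → ℕ.+-cancelˡ-≤ k₁ _ _ (ℕ.≤-trans k₁+k₂≤k (least _ (candidate-⊔ G G₁ G₂ G≅ cand₁ c)))) ,
      ℕ.≤-antisym (least _ (candidate-⊔ G G₁ G₂ G≅ cand₁ cand₂)) k₁+k₂≤k

  least-candidate-⊔ : ∀ {k₁ k₂} → IsLeast (Candidate G₁) k₁ → IsLeast (Candidate G₂) k₂ →
                      IsLeast (Candidate G) (k₁ + k₂)
  least-candidate-⊔ {k₁} {k₂} (cand₁ , least₁) (cand₂ , least₂) =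
    candidate-⊔ G G₁ G₂ G≅ cand₁ cand₂ , λ n c → above (candidate-split G G₁ G₂ G≅ c)
    where
    above : ∀ {n} → ∃[ s₁ ] ∃[ s₂ ] (Candidate G₁ s₁ × Candidate G₂ s₂ × s₁ + s₂ ≤ n) → k₁ + k₂ ≤ n
    above (s₁ , s₂ , c₁ , c₂ , s₁+s₂≤n) =
      ℕ.≤-trans (ℕ.+-mono-≤ (least₁ s₁ c₁) (least₂ s₂ c₂)) s₁+s₂≤n

theorem3p1 : (G G₁ G₂ : Graph) → G ≅ (G₁ ⊔ G₂) →
    (k : ℕ) →
    IsSpectatorFloor G k ⇔
    (∃[ k₁ ] ∃[ k₂ ] (IsSpectatorFloor G₁ k₁ × IsSpectatorFloor G₂ k₂ × k ≡ k₁ + k₂))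
theorem3p1 G G₁ G₂ G≅ k = mk⇔
  (λ floor → let k₁ , k₂ , least₁ , least₂ , k≡ = least-candidate-split G G₁ G₂ G≅ (floor⇒least {G} {k} floor) in
    k₁ , k₂ , least⇒floor {G₁} {k₁} least₁ , least⇒floor {G₂} {k₂} least₂ , k≡)
  λ { (k₁ , k₂ , floor₁ , floor₂ , refl) → least⇒floor {G} {k}
        (least-candidate-⊔ G G₁ G₂ G≅ (floor⇒least {G₁} {k₁} floor₁) (floor⇒least {G₂} {k₂} floor₂)) }
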